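{- Let $m \ge 1$, let $\Sigma_1,\dots,\Sigma_m$ and $\Delta_1,\dots,\Delta_m$ be (possibly infinite) sets, and let $P \subseteq \Sigma_1 \times \cdots \times \Sigma_m$, $Q \subseteq \Delta_1 \times \cdots \times \Delta_m$, and $\Phi \subseteq \Delta_1^{\Sigma_1} \times \cdots \times \Delta_m^{\Sigma_m}$. Suppose that $|\Sigma_i| \ge 2$ for all $i$, and that $P$ has full projections, i.e. $P|_i = \Sigma_i$ for all $i$. Then the relation pair $(P,Q)$ is $\Phi$-certificate-trivial for all $n \ge 1$ if and only if it is $\Phi$-certificate-trivial for $n=2$.
   Context: Here $[n] = \{1,\dots,n\}$, $\Delta^{\Sigma}$ is the set of all functions $\Sigma \to \Delta$, and $P|_i = \{x_i : x \in P\}$. Let $P \subseteq \Sigma_1 \times \cdots \times \Sigma_m$ and $Q \subseteq \Delta_1 \times \cdots \times \Delta_m$. An $n$-ary polymorphism of $(P,Q)$ is an $m$-tuple of functions $(f_1,\dots,f_m)$, where $f_i\colon \Sigma_i^n \to \Delta_i$, such that whenever $x^{(1)},\dots,x^{(n)} \in P$, we have $(f_1(x^{(1)}_1,\dots,x^{(n)}_1), \dots, f_m(x^{(1)}_m,\dots,x^{(n)}_m)) \in Q$. Let $\Phi \subseteq \Delta_1^{\Sigma_1} \times \cdots \times \Delta_m^{\Sigma_m}$. An $m$-tuple of functions $(f_1,\dots,f_m)$, where $f_i\colon \Sigma_i^n \to \Delta_i$, is $\Phi$-certificate-trivial if at least one of the following holds: (Dictator type) there exist $s \in [n]$ and $(\phi_1,\dots,\phi_m)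 \in \Phi$ such that $f_i(x) = \phi_i(x_s)$ for all $i \in [m]$ and all $x \in \Sigma_i^n$; (Certificate type) there exist a subset $I \subseteq [m]$ and symbols $\delta_i \in \Delta_i$ for all $i \in I$ such that (i) $f_i$ is constantly equal to $\delta_i$ for all $i \in I$, and (ii) every $x \in \Delta_1 \times \cdots \times \Delta_m$ satisfying $x_i = \delta_i$ for all $i \in I$ belongs to $Q$. The relation pair $(P,Q)$ is $\Phi$-certificate-trivial for $n$, where $n \ge 1$, if every $n$-ary polymorphism of $(P,Q)$ is $\Phi$-certificate-trivial. -}

module Defs where

open import Data.Fin using (Fin)
open import Data.Fin.Subset using (Subset) renaming (_∈_ to _∈ˢ_)
open import Data.Nat using (ℕ)
open import Data.Product using (_×_; ∃; ∃₂; ∃-syntax)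
open import Data.Sum using (_⊎_)
open import Data.Vec using (Vec; lookup; tabulate)
open import Level using (Level; _⊔_; suc)
open import Relation.Binary.PropositionalEquality using (_≡_; _≢_)
open import Relation.Unary using (Pred; _∈_)

private variable
  a b p q r : Level
  m n : ℕ

Tuple : (Fin m → Set a) → Set a
Tuple Σ = ∀ i → Σ i

-- A subset of Σ₁ × ⋯ × Σₘ.  Tuples are functions, and function extensionality
-- is not assumed, so membership is required to respect componentwise equality.
record TupleSet (Σ : Fin m → Set a) (p : Level) : Set (a ⊔ suc p) where
  field
    Member : Pred (Tuple Σ) p
    resp   : ∀ {x y} → (∀ i → x i ≡ y i) → Member x → Member y

open TupleSet public

infix 4 _∈ᵗ_

_∈ᵗ_ : {Σ : Fin m → Set a} → Tuple Σ → TupleSet Σ p → Set p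
x ∈ᵗ P = x ∈ Member P

AtLeastTwoElements : Set a → Set a
AtLeastTwoElements A = ∃₂ λ (x y : A) → x ≢ y

FullProjections : {Σ : Fin m → Set a} → TupleSet Σ p → Set (a ⊔ p)
FullProjections {Σ = Σ} P = ∀ i (σ : Σ i) → ∃[ x ] x ∈ᵗ P × x i ≡ σ

module _ {Σ : Fin m → Set a} {Δ : Fin m → Set b} where

  Operations : ℕ → Set (a ⊔ b)
  Operations n = ∀ i → Vec (Σ i) n → Δ i

  IsPolymorphism : TupleSet Σ p → TupleSet Δ q → Operations n → Set (a ⊔ p ⊔ q)
  IsPolymorphism {n = n} P Q f =
    (x : Fin n → Tuple Σ) → (∀ k → x k ∈ᵗ P) →
    (λ i → f i (tabulate λ k → x k i)) ∈ᵗ Q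

  -- Φ need not respect pointwise equality of functions: it is only ever
  -- consulted up to that equality.
  DictatorType : Pred (∀ i → Σ i → Δ i) r → Operations n → Set (a ⊔ b ⊔ r)
  DictatorType {n = n} Φ f =
    ∃[ s ] ∃[ φ ] φ ∈ Φ × (∀ i (x : Vec (Σ i) n) → f i x ≡ φ i (lookup x s))

  CertificateType : TupleSet Δ q → Operations n → Set (a ⊔ b ⊔ q)
  CertificateType {n = n} Q f =
    ∃ λ (I : Subset m) → ∃ λ (δ : ∀ i → i ∈ˢ I → Δ i) →
      (∀ i (i∈I : i ∈ˢ I) (x : Vec (Σ i) n) → f i x ≡ δ i i∈I) ×
      (∀ (y : Tuple Δ) → (∀ i (i∈I : i ∈ˢ I) → y i ≡ δ i i∈I) → y ∈ᵗ Q)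

  CertificateTrivial : Pred (∀ i → Σ i → Δ i) r → TupleSet Δ q →
                       Operations n → Set (a ⊔ b ⊔ q ⊔ r)
  CertificateTrivial Φ Q f = DictatorType Φ f ⊎ CertificateType Q f

  CertificateTrivialFor : Pred (∀ i → Σ i → Δ i) r → TupleSet Σ p → TupleSet Δ q →
                          ℕ → Set (a ⊔ b ⊔ p ⊔ q ⊔ r)
  CertificateTrivialFor Φ P Q n =
    (f : Operations n) → IsPolymorphism P Q f → CertificateTrivial Φ Q f

{-# OPTIONS --safe #-}

-- Induction on the arity, where a nullary polymorphism is always of certificate
-- type.  Fix the first argument of an (n+1)-ary polymorphism f to some z ∈ P.
--
-- If such a slice is not of certificate type, it is a dictator φ in some
-- argument s.  Varying only the first argument and the argument s gives binary
-- polymorphisms, and these can only be the dictator φ in s, so f is too.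
--
-- Otherwise every slice has a certificate.  Whether fᵢ(c, ·) is constant depends
-- on c alone, so consider the binary Fᵢ(c, y) which is the value of fᵢ(c, ·)
-- if that is constant, and which genuinely depends on y if not.  The
-- certificates of the slices make F a polymorphism, and its triviality
-- transfers back to f.
module Submission where

open import Axiom.ExcludedMiddle using (ExcludedMiddle)
open import Data.Fin using (Fin; zero; suc)
open import Data.Fin.Subset using (⊤)
open import Data.Fin.Subset.Properties using (∈⊤)
open import Data.Nat using (ℕ; zero; suc; _≥_; s≤s; z≤n)
open import Data.Product using (_×_; _,_; proj₁; proj₂; ∃-syntax)
open import Data.Sum using (inj₁; inj₂)
open import Data.Vec using (Vec; []; _∷_; lookup; tabulate; replicate; _[_]≔_)
open import Data.Vec.Functional using (updateAt)
open import Data.Vec.Properties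
  using (tabulate-cong; tabulate∘lookup; []≔-lookup; lookup∘update)
open import Function.Base using (const)
open import Function.Bundles using (_⇔_; mk⇔)
open import Level using (Level; _⊔_; Lift; lift; lower)
open import Relation.Binary.PropositionalEquality
  using (_≡_; _≢_; refl; sym; trans; cong; module ≡-Reasoning)
open import Relation.Nullary using (¬_; Dec; yes; no; contradiction)
open import Relation.Nullary.Decidable using (map′; decidable-stable)
open import Relation.Unary using (Pred)
open import Defs

lowerExcludedMiddle : ∀ {a} b → ExcludedMiddle (a ⊔ b) → ExcludedMiddle a
lowerExcludedMiddle b em {A} = map′ lower lift (em {Lift b A})

tabulate-updateAt : ∀ {a c n} {T : Set a} {A : Set c} (π : T → A)
                    (w : Fin n → T) (s : Fin n) (x : T) →
                    tabulate (λ k → π (updateAt w s (const x) k)) ≡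
                    tabulate (λ k → π (w k)) [ s ]≔ π x
tabulate-updateAt π w zero    x = refl
tabulate-updateAt π w (suc s) x =
  cong (π (w zero) ∷_) (tabulate-updateAt π (λ k → w (suc k)) s x)

updateAt-∈ : ∀ {a p m n} {Σ : Fin m → Set a} (P : TupleSet Σ p)
             {w : Fin n → Tuple Σ} (s : Fin n) {x : Tuple Σ} →
             (∀ k → w k ∈ᵗ P) → x ∈ᵗ P → ∀ k → updateAt w s (const x) k ∈ᵗ P
updateAt-∈ P zero    w∈P x∈P zero    = x∈P
updateAt-∈ P zero    w∈P x∈P (suc k) = w∈P (suc k)
updateAt-∈ P (suc s) w∈P x∈P zero    = w∈P zero
updateAt-∈ P (suc s) w∈P x∈P (suc k) = updateAt-∈ P s (λ k → w∈P (suc k)) x∈P k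

fullProjections-nonempty : ∀ {a p m} {Σ : Fin m → Set a} {P : TupleSet Σ p} →
  m ≥ 1 → (∀ i → AtLeastTwoElements (Σ i)) → FullProjections P → ∃[ x ] x ∈ᵗ P
fullProjections-nonempty (s≤s z≤n) two full
  with x , x∈P , _ ← full zero (proj₁ (two zero)) = x , x∈P

module _ {a b p q r : Level} (em : ExcludedMiddle (a ⊔ b ⊔ p ⊔ q ⊔ r))
  {m : ℕ} {Σ : Fin m → Set a} {Δ : Fin m → Set b}
  (P : TupleSet Σ p) (Q : TupleSet Δ q) (Φ : Pred (∀ i → Σ i → Δ i) r)
  where

  private
    Ops : ℕ → Set (a ⊔ b)
    Ops n = Operations {Σ = Σ} {Δ = Δ} n

    variable
      n : ℕ

  -- Certify with all coordinates: the only tuple matching `y` everywhere is `y` itself, up to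
  -- pointwise equality.
  constant⇒certificate : (f : Ops n) (y : Tuple Δ) → y ∈ᵗ Q →
                         (∀ i v → f i v ≡ y i) → CertificateType Q f
  constant⇒certificate f y y∈Q f≡y =
    ⊤ , (λ i _ → y i) , (λ i _ v → f≡y i v) ,
    λ y′ y′≡y → resp Q (λ i → sym (y′≡y i ∈⊤)) y∈Q

  slice : Ops (suc n) → Tuple Σ → Ops n
  slice f z i v = f i (z i ∷ v)

  slice-polymorphism : (f : Ops (suc n)) → IsPolymorphism P Q f →
                       ∀ {z} → z ∈ᵗ P → IsPolymorphism P Q (slice f z)
  slice-polymorphism f poly {z} z∈P x x∈P =
    poly (λ { zero → z ; (suc k) → x k }) (λ { zero → z∈P ; (suc k) → x∈P k })

  -- The first argument goes to position `s` of the tail and the second to the head of `f`, so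
  -- setting the second to `z i` lands in the slice at `z`.
  plane : Ops (suc n) → (Fin n → Tuple Σ) → Fin n → Ops 2
  plane f w s i (c ∷ d ∷ []) = f i (d ∷ (tabulate (λ k → w k i) [ s ]≔ c))

  plane-polymorphism : (f : Ops (suc n)) → IsPolymorphism P Q f →
                       ∀ {w} → (∀ k → w k ∈ᵗ P) → ∀ s →
                       IsPolymorphism P Q (plane f w s)
  plane-polymorphism f poly {w} w∈P s x x∈P =
    resp Q
      (λ i → cong (λ v → f i (x (suc zero) i ∷ v))
                  (tabulate-updateAt (λ t → t i) w s (x zero)))
      (slice-polymorphism f poly (x∈P (suc zero))
        (updateAt w s (const (x zero)))
        (updateAt-∈ P s w∈P (x∈P zero)))

  module _ (trivial₂ : CertificateTrivialFor Φ P Q 2) where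

    dictatorSlice⇒dictator :
      FullProjections P → (f : Ops (suc n)) → IsPolymorphism P Q f →
      ∀ {z} → z ∈ᵗ P → ¬ CertificateType Q (slice f z) →
      DictatorType Φ (slice f z) → DictatorType Φ f
    dictatorSlice⇒dictator {n} full f poly {z} z∈P ¬cert (s , φ , φ∈Φ , slice≡φ) =
      suc s , φ , φ∈Φ , f≡φ
      where
      plane≡φ : ∀ w → (∀ k → w k ∈ᵗ P) →
                ∀ i c d → plane f w s i (c ∷ d ∷ []) ≡ φ i c
      plane≡φ w w∈P = go (trivial₂ (plane f w s) (plane-polymorphism f poly w∈P s))
        where
        plane-z : ∀ i c → plane f w s i (c ∷ z i ∷ []) ≡ φ i c
        plane-z i c =
          trans (slice≡φ i _) (cong (φ i) (lookup∘update s (tabulate λ k → w k i) c))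

        go : CertificateTrivial Φ Q (plane f w s) →
             ∀ i c d → plane f w s i (c ∷ d ∷ []) ≡ φ i c
        -- The value does not depend on `d`, so it can be read off at `d = z i`.
        go (inj₁ (zero , ψ , _ , plane≡ψ)) i c d =
          trans (plane≡ψ i (c ∷ d ∷ []))
                (trans (sym (plane≡ψ i (c ∷ z i ∷ []))) (plane-z i c))
        -- At `d = z i` the plane is both `φ i c` and `ψ i (z i)`, so every `φ i` is constant. The
        -- slice is then constant, and its value lies in `Q` as its image of copies of `z`.
        go (inj₁ (suc zero , ψ , _ , plane≡ψ)) =
          contradiction
            (constant⇒certificate (slice f z) (λ i → ψ i (z i))
              (resp Q (λ i → slice≡ψz i (tabulate λ _ → z i))
                (slice-polymorphism f poly z∈P (λ _ → z) (λ _ → z∈P)))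
              slice≡ψz)
            ¬cert
          where
          slice≡ψz : ∀ i v → slice f z i v ≡ ψ i (z i)
          slice≡ψz i v =
            trans (slice≡φ i v)
                  (trans (sym (plane-z i (lookup v s))) (plane≡ψ i _))
        -- Restricting to `d = z i` shows that `φ i` is constantly `δ i` on `I`, so the certificate
        -- passes to the slice.
        go (inj₂ (I , δ , plane≡δ , force)) =
          contradiction
            (I , δ ,
             (λ i i∈I v → trans (slice≡φ i v)
               (trans (sym (plane-z i (lookup v s))) (plane≡δ i i∈I _))) ,
             force)
            ¬cert

      f≡φ : ∀ i v → f i v ≡ φ i (lookup v (suc s))
      f≡φ i (d ∷ v) = begin
        f i (d ∷ v)                           ≡⟨ cong (λ u → f i (d ∷ u)) ([]≔-lookup v s) ⟨
        f i (d ∷ (v [ s ]≔ lookup v s))       ≡⟨ cong (λ u → f i (d ∷ (u [ s ]≔ lookup v s))) w≡v ⟨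
        plane f w s i (lookup v s ∷ d ∷ [])   ≡⟨ plane≡φ w (λ k → proj₁ (proj₂ (full i (lookup v k)))) i _ d ⟩
        φ i (lookup v s)                      ∎
        where
        open ≡-Reasoning
        -- Members of `P` whose `i`-th coordinates spell out `v`. The choice may vary with `i`,
        -- since only coordinate `i` is compared here.
        w : Fin n → Tuple Σ
        w k = proj₁ (full i (lookup v k))

        w≡v : tabulate (λ k → w k i) ≡ v
        w≡v = trans (tabulate-cong (λ k → proj₂ (proj₂ (full i (lookup v k)))))
                    (tabulate∘lookup v)

    certificateSlices⇒trivial :
      (∀ i → AtLeastTwoElements (Σ i)) → ∃[ z ] z ∈ᵗ P → (f : Ops (suc n)) →
      (∀ z → z ∈ᵗ P → CertificateType Q (slice f z)) → CertificateTrivial Φ Q f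
    certificateSlices⇒trivial {n} two (z₀ , z₀∈P) f certs = conclude (trivial₂ F F-poly)
      where
      y₀ y₁ : ∀ i → Σ i
      y₀ i = proj₁ (two i)
      y₁ i = proj₁ (proj₂ (two i))

      y₀≢y₁ : ∀ i → y₀ i ≢ y₁ i
      y₀≢y₁ i = proj₂ (proj₂ (two i))

      -- An arbitrary reference value of `f i (c ∷ _)`; repeating `c` merely supplies some tail.
      base : ∀ i → Σ i → Δ i
      base i c = f i (c ∷ replicate n c)

      NonConstantAt : ∀ i → Σ i → Set (a ⊔ b)
      NonConstantAt i c = ∃[ v ] f i (c ∷ v) ≢ base i c

      nonConstantAt? : ∀ i c → Dec (NonConstantAt i c)
      nonConstantAt? i c = lowerExcludedMiddle (p ⊔ q ⊔ r) em

      _≟_ : ∀ {i} (c d : Σ i) → Dec (c ≡ d)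
      c ≟ d = lowerExcludedMiddle (b ⊔ p ⊔ q ⊔ r) em

      value : ∀ {i c} → Dec (NonConstantAt i c) →
              ∀ {y} → Dec (y ≡ y₀ i) → Δ i
      -- At `y₀ i` take the value at the witness `v`, elsewhere the base value: the two differ, and
      -- `y₁ i` is a place where the latter occurs.
      value {i} {c} (yes (v , _)) (yes _) = f i (c ∷ v)
      value {i} {c} (yes _)       (no _)  = base i c
      value {i} {c} (no _)        _       = base i c

      F : Ops 2
      F i (c ∷ y ∷ []) = value (nonConstantAt? i c) (y ≟ y₀ i)

      -- Every value of `F i` at first argument `c` is a value of `f i (c ∷ _)`.
      constant⇒F≡f : ∀ i c {d} → (∀ v → f i (c ∷ v) ≡ d) → ∀ y → F i (c ∷ y ∷ []) ≡ d
      constant⇒F≡f i c f≡d y with nonConstantAt? i c | y ≟ y₀ i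
      ... | yes (v , _) | yes _ = f≡d v
      ... | yes _       | no _  = f≡d _
      ... | no _        | _     = f≡d _

      F-constant⇒f≡F : ∀ i c {d} → (∀ y → F i (c ∷ y ∷ []) ≡ d) → ∀ v → f i (c ∷ v) ≡ d
      F-constant⇒f≡F i c F≡d v
        with nonConstantAt? i c | F≡d
      ... | no ¬nonconst | F≡d′ =
        trans (decidable-stable (lowerExcludedMiddle (a ⊔ p ⊔ q ⊔ r) em)
                (λ fv≢ → ¬nonconst (v , fv≢)))
              (F≡d′ c)
      -- Comparing `F` at `y₀ i` and `y₁ i` equates the witness value with the base value, against
      -- `fu≢`.
      ... | yes (u , fu≢) | F≡d′
        with y₀ i ≟ y₀ i | F≡d′ (y₀ i) | y₁ i ≟ y₀ i | F≡d′ (y₁ i)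
      ... | yes _    | fu≡d | no _      | base≡d = contradiction (trans fu≡d (sym base≡d)) fu≢
      ... | no y₀≢y₀ | _    | _         | _      = contradiction refl y₀≢y₀
      ... | _        | _    | yes y₁≡y₀ | _      = contradiction (sym y₁≡y₀) (y₀≢y₁ i)

      F-poly : IsPolymorphism P Q F
      F-poly x x∈P
        -- On `I` the slice at `x zero` is constant, so `F` returns `δ` there for any second
        -- argument, which already forces membership in `Q`.
        with I , δ , slice≡δ , force ← certs (x zero) (x∈P zero) =
        force _ λ i i∈I → constant⇒F≡f i (x zero i) (slice≡δ i i∈I) (x (suc zero) i)

      conclude : CertificateTrivial Φ Q F → CertificateTrivial Φ Q f
      -- For fixed `c`, `F i` is constantly `φ i c`, and hence so is `f i (c ∷ _)`.
      conclude (inj₁ (zero , φ , φ∈Φ , F≡φ)) =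
        inj₁ (zero , φ , φ∈Φ ,
              λ { i (c ∷ v) → F-constant⇒f≡F i c (λ y → F≡φ i (c ∷ y ∷ [])) v })
      -- Here F ignores its first argument, so a certificate for the single
      -- slice at z₀ is one for all of f.
      conclude (inj₁ (suc zero , φ , φ∈Φ , F≡φ))
        with I , δ , slice≡δ , force ← certs z₀ z₀∈P =
        inj₂ (I , δ ,
              (λ { i i∈I (c ∷ v) → F-constant⇒f≡F i c
                (λ y → trans (F≡φ i (c ∷ y ∷ []))
                         (trans (sym (F≡φ i (z₀ i ∷ y ∷ [])))
                           (constant⇒F≡f i (z₀ i) (slice≡δ i i∈I) y))) v }) ,
              force)
      conclude (inj₂ (I , δ , F≡δ , force)) =
        inj₂ (I , δ ,
              (λ { i i∈I (c ∷ v) →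
                F-constant⇒f≡F i c (λ y → F≡δ i i∈I (c ∷ y ∷ [])) v }) ,
              force)

    trivial₂⇒trivial : (∀ i → AtLeastTwoElements (Σ i)) → FullProjections P →
                       ∃[ z ] z ∈ᵗ P → ∀ n → CertificateTrivialFor Φ P Q n
    trivial₂⇒trivial two full nonempty zero f poly =
      inj₂ (constant⇒certificate f (λ i → f i []) (poly (λ ()) (λ ())) λ { i [] → refl })
    trivial₂⇒trivial two full nonempty (suc n) f poly
      -- The induction hypothesis is applied only to a slice without a certificate, where it must
      -- give a dictator.
      with lowerExcludedMiddle r em
             {∃[ z ] z ∈ᵗ P × ¬ CertificateType Q (slice f z)}
    ... | no ¬∃ =
      certificateSlices⇒trivial two nonempty f λ z z∈P →
        decidable-stable (lowerExcludedMiddle (p ⊔ r) em)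
          (λ ¬cert → ¬∃ (z , z∈P , ¬cert))
    ... | yes (z , z∈P , ¬cert)
      with trivial₂⇒trivial two full nonempty n (slice f z) (slice-polymorphism f poly z∈P)
    ...   | inj₁ dict = inj₁ (dictatorSlice⇒dictator full f poly z∈P ¬cert dict)
    ...   | inj₂ cert = contradiction cert ¬cert

corollary3p3 : ∀ {a b p q r : Level} →
    ExcludedMiddle (a ⊔ b ⊔ p ⊔ q ⊔ r) →
    (m : ℕ) → m ≥ 1 →
    (Σ : Fin m → Set a) (Δ : Fin m → Set b) →
    (P : TupleSet Σ p) (Q : TupleSet Δ q) →
    (Φ : Pred (∀ i → Σ i → Δ i) r) →
    (∀ i → AtLeastTwoElements (Σ i)) →
    FullProjections P →
    (∀ n → n ≥ 1 → CertificateTrivialFor Φ P Q n) ⇔ CertificateTrivialFor Φ P Q 2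
corollary3p3 em m m≥1 Σ Δ P Q Φ two full = mk⇔
  (λ trivial → trivial 2 (s≤s z≤n))
  (λ trivial₂ n _ → trivial₂⇒trivial em P Q Φ trivial₂ two full
    (fullProjections-nonempty {P = P} m≥1 two full) n)
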